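{- Let $G$ be a graph. Then every connected induced subgraph of $G$ is dominated by an induced complete split graph (that is, for every connected induced subgraph $F$ of $G$ there is a dominating set $D$ of $F$ such that the induced subgraph $F[D]$ is a complete split graph) if and only if $G$ is $\mathcal{D}$-free, where $\mathcal{D}=\{P_6,C_6,Q_2,Q_5\}$.
   Context: All graphs are finite and simple. $P_\ell$ and $C_\ell$ denote the chordless path and the chordless cycle on $\ell$ vertices. For a set $\mathcal{L}$ of graphs, a graph is $\mathcal{L}$-free if it contains no induced subgraph isomorphic to a member of $\mathcal{L}$. A set $D\subseteq V(F)$ is a dominating set of a graph $F$ if every vertex of $V(F)\setminus D$ is adjacent to some vertex of $D$. A clique (stable set) is a set of mutually adjacent (non-adjacent) vertices. A split graph is a graph whose vertex set can be partitioned into a stable set and a clique. A complete split graph is a split graph where every vertex of the stable set is adjacent to every vertex of the clique. Attaching a leaf to a vertex $u$ of a graph means adding a new vertex $u'$ and the single edge $uu'$. $Q_2$ is the graph obtained from $C_4$ by attaching one leaf to each of its four vertices. The paw is the graph with vertices $a,b,c,d$ and edges $ab,bc,ca,ad$. $Q_5$ is the graph obtained from the paw by attaching one leaf to each of its non-cut vertices $b,c,d$.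
   Formalization: The clique of a complete split graph is required to be nonempty (the stable set may be empty); if it could be empty, any maximal stable set would dominate and the equivalence would fail, for example for P_6. -}

module Defs where

open import Level using (0ℓ)
open import Data.Nat as ℕ using (ℕ; _+_; _%_; NonZero)
open import Data.Fin using (Fin; zero; suc; toℕ; _↑ʳ_)
open import Data.Fin.Patterns using (0F; 1F; 2F; 3F)
open import Data.Fin.Properties using (_≟_)
open import Data.Fin.Subset using (Subset; _∈_; _∉_; _⊆_; _∩_; _∪_; Nonempty; Empty)
open import Data.List using (List; []; _∷_)
open import Data.List.Relation.Unary.All using (All)
open import Data.List.Membership.Propositional using () renaming (_∈_ to _∈ˡ_)
import Data.List.Membership.DecPropositional as DecMembership
open import Data.Vec using (Vec; []; _∷_; allFin)
open import Data.Product using (∃; ∃-syntax; _×_; _,_; proj₁)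
open import Data.Product.Properties using (≡-dec)
open import Data.Sum using (_⊎_; swap)
open import Data.Empty using (⊥)
open import Function using (_on_; _∘_; _↔_; _⇔_; Inverse)
open import Relation.Binary using (Rel; Decidable; Symmetric; Irreflexive)
open import Relation.Binary.Construct.Closure.ReflexiveTransitive using (Star)
open import Relation.Binary.PropositionalEquality using (_≡_; _≢_; refl; sym)
open import Relation.Nullary using (¬_; no)
open import Relation.Nullary.Decidable using (¬?; _×-dec_; _⊎-dec_)

record Graph (n : ℕ) : Set₁ where
  field
    Adj    : Rel (Fin n) 0ℓ
    adj?   : Decidable Adj
    symm   : Symmetric Adj
    irrefl : Irreflexive _≡_ Adj

open Graph public

-- An induced subgraph G[X] is given by its vertex set X.
Vertex : ∀ {n} → Subset n → Set
Vertex X = ∃[ v ] v ∈ X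

AdjIn : ∀ {n} → Graph n → (X : Subset n) → Rel (Vertex X) 0ℓ
AdjIn G X = Adj G on proj₁

-- The null graph is not regarded as connected.
Connected : ∀ {n} → Graph n → Subset n → Set
Connected G X = Nonempty X × (∀ (u v : Vertex X) → Star (AdjIn G X) u v)

Dominating : ∀ {n} → Graph n → (X D : Subset n) → Set
Dominating G X D =
  D ⊆ X × (∀ {v} → v ∈ X → v ∉ D → ∃[ u ] (u ∈ D × Adj G v u))

Stable : ∀ {n} → Graph n → Subset n → Set
Stable G S = ∀ {u v} → u ∈ S → v ∈ S → ¬ Adj G u v

Clique : ∀ {n} → Graph n → Subset n → Set
Clique G K = ∀ {u v} → u ∈ K → v ∈ K → u ≢ v → Adj G u v

-- "G[D] is a complete split graph".  The stable part may be empty, but the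
-- clique must not be: otherwise edgeless graphs would qualify, and every graph
-- is dominated by any of its maximal stable sets.  The graphs so defined are
-- exactly the connected complete split graphs.
record CompleteSplit {n} (G : Graph n) (D : Subset n) : Set where
  field
    S K      : Subset n
    cover    : S ∪ K ≡ D
    disjoint : Empty (S ∩ K)
    nonempty : Nonempty K
    stable   : Stable G S
    clique   : Clique G K
    complete : ∀ {s k} → s ∈ S → k ∈ K → Adj G s k

-- An isomorphism from H to the induced subgraph G[X].
record _≅_[_] {m n} (H : Graph m) (G : Graph n) (X : Subset n) : Set where
  field
    bijection : Fin m ↔ Vertex X
    adjacency : ∀ u v →
      Adj H u v ⇔ AdjIn G X (Inverse.to bijection u) (Inverse.to bijection v)

Free : List (∃ Graph) → ∀ {n} → Graph n → Set₁
Free L G = All (λ (_ , H) → ¬ (∃[ X ] H ≅ G [ X ])) L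

-- The simple graph underlying a relation: orientations and loops are forgotten.
underlying : ∀ {n} (R : Rel (Fin n) 0ℓ) → Decidable R → Graph n
underlying R R? = record
  { Adj    = λ u v → u ≢ v × (R u v ⊎ R v u)
  ; adj?   = λ u v → ¬? (u ≟ v) ×-dec (R? u v ⊎-dec R? v u)
  ; symm   = λ (u≢v , e) → u≢v ∘ sym , swap e
  ; irrefl = λ u≡v (u≢v , _) → u≢v u≡v
  }

path : ∀ ℓ → Graph ℓ
path ℓ = underlying (λ u v → 1 + toℕ u ≡ toℕ v) (λ u v → 1 + toℕ u ℕ.≟ toℕ v)

-- A cycle in the usual sense only for ℓ ≥ 3.
cycle : ∀ ℓ → .{{NonZero ℓ}} → Graph ℓ
cycle ℓ = underlying (λ u v → (1 + toℕ u) % ℓ ≡ toℕ v)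
                     (λ u v → (1 + toℕ u) % ℓ ℕ.≟ toℕ v)

-- The leaf is vertex zero; each old vertex v becomes suc v.
attachLeaf : ∀ {n} → Graph n → Fin n → Graph (1 + n)
attachLeaf {n} G u = record
  { Adj    = A
  ; adj?   = A?
  ; symm   = λ {v} {w} → A-sym {v} {w}
  ; irrefl = λ {v} {w} → A-irrefl {v} {w}
  }
  where
  A : Rel (Fin (1 + n)) 0ℓ
  A zero    zero    = ⊥
  A zero    (suc w) = w ≡ u
  A (suc v) zero    = v ≡ u
  A (suc v) (suc w) = Adj G v w

  A? : Decidable A
  A? zero    zero    = no λ ()
  A? zero    (suc w) = w ≟ u
  A? (suc v) zero    = v ≟ u
  A? (suc v) (suc w) = adj? G v w

  A-sym : Symmetric A
  A-sym {zero}  {suc w} e = e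
  A-sym {suc v} {zero}  e = e
  A-sym {suc v} {suc w} e = symm G e

  A-irrefl : Irreflexive _≡_ A
  A-irrefl {suc v} refl e = irrefl G refl e

-- One leaf for each entry; k ↑ʳ u is the vertex u of G after k leaves have
-- been added.
attachLeaves : ∀ {n k} → Graph n → Vec (Fin n) k → Graph (k + n)
attachLeaves G [] = G
attachLeaves {k = ℕ.suc k} G (u ∷ us) = attachLeaf (attachLeaves G us) (k ↑ʳ u)

-- a, b, c, d are 0, 1, 2, 3.
paw : Graph 4
paw = underlying (λ u v → (u , v) ∈ˡ edges) (λ u v → (u , v) ∈? edges)
  where
  open DecMembership (≡-dec (_≟_ {4}) (_≟_ {4})) using (_∈?_)
  edges : List (Fin 4 × Fin 4)
  edges = (0F , 1F) ∷ (1F , 2F) ∷ (2F , 0F) ∷ (0F , 3F) ∷ []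

Q₂ : Graph 8
Q₂ = attachLeaves (cycle 4) (allFin 4)

Q₅ : Graph 7
Q₅ = attachLeaves paw (1F ∷ 2F ∷ 3F ∷ [])

𝒟 : List (∃ Graph)
𝒟 = (_ , path 6) ∷ (_ , cycle 6) ∷ (_ , Q₂) ∷ (_ , Q₅) ∷ []

{-# OPTIONS --safe #-}
-- If G contains a copy of an obstruction H, a complete split dominating set of
-- that copy lies in the closed neighbourhood of one of its vertices i. In P₆, C₆
-- and Q₂ some closed neighbourhood N[j] misses N[i]. In Q₅ this fails only for
-- i = a; then the set must contain b, c and d, but bc is an edge while d sees
-- neither b nor c.
--
-- Conversely, take a connected dominating set D of minimum size. A vertex y whose
-- removal leaves D nonempty and connected has a private neighbour y′ outside
-- D. Removing an end of a longest induced path of D keeps D connected, so private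
-- neighbours at the ends turn an induced P₄ in D into a P₆ or C₆. Thus D is
-- P₄-free, and any end y of an induced P₃ in D is then removable. Exchange: if a
-- private neighbour s′ of s is adjacent to all private neighbours of y, then
-- D − y + s′ is again a minimum connected dominating set. For a paw with centre k,
-- triangle k y t and leaf s, exchanging y or t for s′ would create the P₄ t k s s′
-- or y k s s′; so y′ and t′ may be chosen nonadjacent to s′, which gives Q₅ or a
-- long path or cycle. For a C₄ in D, exchanging one vertex for a private neighbour
-- of the opposite vertex either fails for both opposite pairs, giving Q₂, or
-- produces a set with a pendant vertex, which contains no C₄. A connected graph
-- without induced P₄, paw and C₄ is complete split.
module Submission where

open import Data.Nat using (ℕ; zero; suc; _≤_; s≤s)
import Data.Nat.Properties as ℕ
open import Data.Nat.Induction using (<-rec)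
open import Data.Bool using (Bool; true; false)
open import Data.Bool.Properties using () renaming (_≟_ to _≟ᵇ_)
open import Data.Unit using (⊤; tt)
open import Data.Empty using (⊥; ⊥-elim)
open import Data.Product using (∃; ∃-syntax; _×_; _,_; proj₁; proj₂; uncurry)
open import Data.Sum using (_⊎_; inj₁; inj₂; [_,_]′)
open import Data.Fin using (Fin; zero; suc)
open import Data.Fin.Patterns using (0F; 2F; 3F; 4F)
open import Data.Fin.Properties using (_≟_; any?; all?)
open import Data.Fin.Subset using (Subset; inside; outside; _∈_; _∉_; _⊆_; _∩_; _∪_; _-_; ⁅_⁆; ∣_∣; Nonempty; Empty)
open import Data.Fin.Subset.Properties
  using ( _∈?_; _⊆?_; Lift?; nonempty?; anySubset?; ⊆-antisym; ⊆-refl; ∪-identityʳ; x∈⁅x⁆; x∈⁅y⁆⇒x≡y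
        ; x∈p∪q⁺; x∈p∪q⁻; x∈p∩q⁻; p─q⊆p; x∈p∧x≢y⇒x∈p-y; x∈p⇒∣p-x∣<∣p∣)
open import Data.Vec as Vec using (Vec; []; _∷_; here; there)
open import Data.Vec.Properties using (lookup∘tabulate; lookup⇒[]=; []=⇒lookup; ≡-dec)
open import Data.Vec.Properties.WithK using ([]=-irrelevant)
open import Data.List using (List; []; _∷_)
open import Data.List.Relation.Unary.All as All using (All; []; _∷_)
open import Data.List.Relation.Unary.All.Properties using (¬Any⇒All¬)
open import Data.List.Relation.Unary.Any as Any using (Any; here; there)
open import Function using (_∘_; id; _⇔_; mk⇔; mk↔ₛ′; Equivalence; Inverse)
open import Relation.Binary.Construct.Closure.ReflexiveTransitive using (Star; ε; _◅_; _◅◅_; gmap; reverse)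
open import Relation.Binary.PropositionalEquality using (_≡_; _≢_; refl; sym; trans; cong; subst)
open import Relation.Nullary using (¬_; Dec; yes; no; does; contradiction)
open import Relation.Nullary.Decidable
  using (¬?; _×-dec_; _⊎-dec_; _→-dec_; map′; dec-true; dec-false; does-⇔; decidable-stable; True; toWitness)
open import Relation.Unary using (Decidable)
open import Defs

private variable
  n m : ℕ

-- Finite subsets

filter : {P : Fin n → Set} → Decidable P → Subset n
filter P? = Vec.tabulate (does ∘ P?)

∈-filter⁺ : {P : Fin n → Set} (P? : Decidable P) {v : Fin n} → P v → v ∈ filter P?
∈-filter⁺ P? {v} p = lookup⇒[]= v _ (trans (lookup∘tabulate _ v) (dec-true (P? v) p))

∈-filter⁻ : {P : Fin n → Set} (P? : Decidable P) {v : Fin n} → v ∈ filter P? → P v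
∈-filter⁻ P? {v} v∈ with P? v | trans (sym (lookup∘tabulate (does ∘ P?) v)) ([]=⇒lookup v∈)
... | yes p | _ = p

x∉p-x : (p : Subset n) (x : Fin n) → x ∉ p - x
x∉p-x (_ ∷ p) (suc x) (there x∈) = x∉p-x p x x∈

∣p∪⁅x⁆∣≤1+∣p∣ : (p : Subset n) (x : Fin n) → ∣ p ∪ ⁅ x ⁆ ∣ ≤ suc ∣ p ∣
∣p∪⁅x⁆∣≤1+∣p∣ (inside  ∷ p) zero    rewrite ∪-identityʳ p = ℕ.n≤1+n _
∣p∪⁅x⁆∣≤1+∣p∣ (outside ∷ p) zero    rewrite ∪-identityʳ p = ℕ.≤-refl
∣p∪⁅x⁆∣≤1+∣p∣ (inside  ∷ p) (suc x) = s≤s (∣p∪⁅x⁆∣≤1+∣p∣ p x)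
∣p∪⁅x⁆∣≤1+∣p∣ (outside ∷ p) (suc x) = ∣p∪⁅x⁆∣≤1+∣p∣ p x

-- Induced copies of a graph

-- A map out of such a graph that preserves and reflects adjacency is injective.
TwinFree : Graph m → Set
TwinFree H = ∀ i j → (∃[ k ] does (adj? H i k) ≢ does (adj? H j k)) ⊎ i ≡ j

module _ (G : Graph n) where

  Related : Bool → Fin n → Fin n → Set
  Related true  u v = Adj G u v
  Related false u v = ¬ Adj G u v

  Row : (Fin m → Bool) → Fin n → Vec (Fin n) m → Set
  Row r u []       = ⊤
  Row r u (v ∷ vs) = Related (r zero) u v × Row (r ∘ suc) u vs

  -- Only the entries above the diagonal are asked for, as nested tuples that unfold for a concrete
  -- graph; symmetry and irreflexivity give the others.
  Realises : (Fin m → Fin m → Bool) → Vec (Fin n) m → Set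
  Realises R []       = ⊤
  Realises R (v ∷ vs) = Row (R zero ∘ suc) v vs × Realises (λ i j → R (suc i) (suc j)) vs

  related-sym : ∀ b {u v} → Related b u v → Related b v u
  related-sym true  uv  = symm G uv
  related-sym false ¬uv = ¬uv ∘ symm G

  row-lookup : (r : Fin m → Bool) {u : Fin n} (vs : Vec (Fin n) m) → Row r u vs →
    ∀ j → Related (r j) u (Vec.lookup vs j)
  row-lookup r (v ∷ vs) (uv , _)   zero    = uv
  row-lookup r (v ∷ vs) (_ , rest) (suc j) = row-lookup (r ∘ suc) vs rest j

  realises-lookup : (R : Fin m → Fin m → Bool) → (∀ i j → R i j ≡ R j i) → (∀ i → R i i ≡ false) →
    (vs : Vec (Fin n) m) → Realises R vs →
    ∀ i j → Related (R i j) (Vec.lookup vs i) (Vec.lookup vs j)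
  realises-lookup R R-sym R-irr (v ∷ vs) _ zero zero =
    subst (λ b → Related b v v) (sym (R-irr zero)) (irrefl G refl)
  realises-lookup R R-sym R-irr (v ∷ vs) (row , _) zero (suc j) = row-lookup _ vs row j
  realises-lookup R R-sym R-irr (v ∷ vs) (row , _) (suc i) zero =
    related-sym (R (suc i) zero) (subst (λ b → Related b v _) (R-sym zero (suc i)) (row-lookup _ vs row i))
  realises-lookup R R-sym R-irr (v ∷ vs) (_ , rest) (suc i) (suc j) =
    realises-lookup _ (λ i j → R-sym (suc i) (suc j)) (R-irr ∘ suc) vs rest i j

  related⇒⇔ : {A : Set} (a? : Dec A) {u v : Fin n} → Related (does a?) u v → A ⇔ Adj G u v
  related⇒⇔ (yes a) uv  = mk⇔ (λ _ → uv) (λ _ → a)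
  related⇒⇔ (no ¬a) ¬uv = mk⇔ (λ a → contradiction a ¬a) (λ uv → contradiction uv ¬uv)

  induced-copy : (H : Graph m) → TwinFree H → (vs : Vec (Fin n) m) →
    Realises (λ i j → does (adj? H i j)) vs → ∃[ X ] H ≅ G [ X ]
  induced-copy H twin-free vs real = image , record
    { bijection = mk↔ₛ′ to from to∘from from∘to
    ; adjacency = preserves
    }
    where
    f = Vec.lookup vs

    preserves : ∀ i j → Adj H i j ⇔ Adj G (f i) (f j)
    preserves i j = related⇒⇔ (adj? H i j) (realises-lookup _
      (λ i j → does-⇔ (mk⇔ (symm H) (symm H)) (adj? H i j) (adj? H j i))
      (λ i → dec-false (adj? H i i) (irrefl H refl)) vs real i j)

    f-injective : ∀ {i j} → f i ≡ f j → i ≡ j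
    f-injective {i} {j} fi≡fj with twin-free i j
    ... | inj₂ i≡j = i≡j
    ... | inj₁ (k , differ) = contradiction
      (does-⇔ (mk⇔ (move (sym fi≡fj)) (move fi≡fj)) (adj? H i k) (adj? H j k)) differ
      where
      move : ∀ {a b} → f a ≡ f b → Adj H b k → Adj H a k
      move {a} {b} fa≡fb bk = Equivalence.from (preserves a k)
        (subst (λ v → Adj G v (f k)) (sym fa≡fb) (Equivalence.to (preserves b k) bk))

    hit? : Decidable (λ v → ∃[ i ] f i ≡ v)
    hit? v = any? (λ i → f i ≟ v)

    image = filter hit?

    to : Fin _ → Vertex image
    to i = f i , ∈-filter⁺ hit? (i , refl)

    from : Vertex image → Fin _
    from (_ , v∈) = proj₁ (∈-filter⁻ hit? v∈)

    to∘from : ∀ x → to (from x) ≡ x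
    to∘from (v , v∈) with ∈-filter⁻ hit? v∈
    ... | i , refl = cong (f i ,_) ([]=-irrelevant _ _)

    from∘to : ∀ i → from (to i) ≡ i
    from∘to i = f-injective (proj₂ (∈-filter⁻ hit? (proj₂ (to i))))

twinFree? : (H : Graph m) → Dec (TwinFree H)
twinFree? H = all? λ i → all? λ j →
  any? (λ k → ¬? (does (adj? H i k) ≟ᵇ does (adj? H j k))) ⊎-dec i ≟ j

-- With these evaluations, a copy of an obstruction can be exhibited without proving its vertices
-- distinct.
P₆-twinFree : TwinFree (path 6)
P₆-twinFree = toWitness {a? = twinFree? (path 6)} tt

C₆-twinFree : TwinFree (cycle 6)
C₆-twinFree = toWitness {a? = twinFree? (cycle 6)} tt

Q₂-twinFree : TwinFree Q₂
Q₂-twinFree = toWitness {a? = twinFree? Q₂} tt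

Q₅-twinFree : TwinFree Q₅
Q₅-twinFree = toWitness {a? = twinFree? Q₅} tt

-- The obstructions are not dominated

-- The bound on the length lets connectedness of an obstruction be settled by evaluation.
Reach : Graph m → ℕ → Fin m → Fin m → Set
Reach H zero    i j = i ≡ j
Reach H (suc k) i j = i ≡ j ⊎ ∃[ w ] (Adj H i w × Reach H k w j)

reach? : (H : Graph m) → ∀ k i j → Dec (Reach H k i j)
reach? H zero    i j = i ≟ j
reach? H (suc k) i j = i ≟ j ⊎-dec any? (λ w → adj? H i w ×-dec reach? H k w j)

reach⇒star : (H : Graph m) → ∀ k {i j} → Reach H k i j → Star (Adj H) i j
reach⇒star H zero    refl                = ε
reach⇒star H (suc k) (inj₁ refl)         = ε
reach⇒star H (suc k) (inj₂ (_ , iw , r)) = iw ◅ reach⇒star H k r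

module _ (H : Graph m) where

  InNbhd : Fin m → Fin m → Set
  InNbhd i t = t ≡ i ⊎ Adj H t i

  inNbhd? : ∀ i t → Dec (InNbhd i t)
  inNbhd? i t = t ≟ i ⊎-dec adj? H t i

  -- A connected complete split dominating set lies in the closed neighbourhood
  -- of some i (any vertex of its clique), so a vertex j can only be dominated
  -- from within N[i] ∩ N[j].
  Far : Fin m → Fin m → Set
  Far i j = ∀ t → InNbhd i t → ¬ InNbhd j t

  -- Nothing in N[i] other than `u` equals or dominates `j`, so a dominating set inside N[i] has to
  -- contain `u`.
  Forced : Fin m → Fin m → Set
  Forced i u = ∃[ j ] ∀ t → InNbhd i t → InNbhd j t → t ≡ u

  -- The three forced vertices induce a co-P₃, which `split-edge` excludes from a complete split
  -- graph.
  ForcedCoP₃ : Fin m → Set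
  ForcedCoP₃ i = ∃[ u ] ∃[ v ] ∃[ w ] (Adj H u v × ¬ Adj H w u × ¬ Adj H w v
                                  × Forced i u × Forced i v × Forced i w)

  Obstructed : Set
  Obstructed = ∀ i → (∃[ j ] Far i j) ⊎ ForcedCoP₃ i

  far? : ∀ i j → Dec (Far i j)
  far? i j = all? λ t → inNbhd? i t →-dec ¬? (inNbhd? j t)

  forced? : ∀ i u → Dec (Forced i u)
  forced? i u = any? λ j → all? λ t → inNbhd? i t →-dec (inNbhd? j t →-dec t ≟ u)

  obstructed? : Dec Obstructed
  obstructed? = all? λ i → any? (far? i) ⊎-dec
    any? λ u → any? λ v → any? λ w → adj? H u v ×-dec (¬? (adj? H w u) ×-dec
      (¬? (adj? H w v) ×-dec (forced? i u ×-dec (forced? i v ×-dec forced? i w))))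

module _ {G : Graph n} {D : Subset n} (split : CompleteSplit G D) where
  open CompleteSplit split

  centre : ∃[ k ] (k ∈ D × ∀ {v} → v ∈ D → v ≡ k ⊎ Adj G v k)
  centre with nonempty
  ... | k , k∈K = k , subst (k ∈_) cover (x∈p∪q⁺ (inj₂ k∈K)) , near
    where
    near : ∀ {v} → v ∈ D → v ≡ k ⊎ Adj G v k
    near {v} v∈D with x∈p∪q⁻ S K (subst (v ∈_) (sym cover) v∈D) | v ≟ k
    ... | _        | yes v≡k = inj₁ v≡k
    ... | inj₁ v∈S | no _    = inj₂ (complete v∈S k∈K)
    ... | inj₂ v∈K | no v≢k  = inj₂ (clique v∈K k∈K v≢k)

  -- The stable part contains no edge, so `u` or `v` lies in the clique and sees every `w` of the
  -- stable part; a `w` in the clique sees everything but itself.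
  split-edge : ∀ {u v w} → u ∈ D → v ∈ D → w ∈ D → Adj G u v → Adj G w u ⊎ Adj G w v
  split-edge {u} {v} {w} u∈D v∈D w∈D uv with part u∈D | part v∈D | part w∈D | w ≟ u
    where
    part : ∀ {x} → x ∈ D → x ∈ S ⊎ x ∈ K
    part {x} x∈D = x∈p∪q⁻ S K (subst (x ∈_) (sym cover) x∈D)
  ... | _        | _        | _        | yes refl = inj₂ uv
  ... | inj₁ u∈S | inj₁ v∈S | inj₁ _   | no _     = contradiction uv (stable u∈S v∈S)
  ... | inj₁ _   | inj₂ v∈K | inj₁ w∈S | no _     = inj₂ (complete w∈S v∈K)
  ... | inj₂ u∈K | _        | inj₁ w∈S | no _     = inj₁ (complete w∈S u∈K)
  ... | inj₁ u∈S | _        | inj₂ w∈K | no _     = inj₁ (symm G (complete u∈S w∈K))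
  ... | inj₂ u∈K | _        | inj₂ w∈K | no w≢u   = inj₁ (clique w∈K u∈K w≢u)

module _ {H : Graph m} {G : Graph n} {X : Subset n} (copy : H ≅ G [ X ]) where
  open _≅_[_] copy
  open Inverse bijection using (to; from; strictlyInverseˡ)

  copy-connected : (r : Fin m) → (∀ i → Star (Adj H) i r) → Connected G X
  copy-connected r to-r = to r , λ x y →
    subst (Star (AdjIn G X) x) (strictlyInverseˡ y)
      (subst (λ x → Star (AdjIn G X) x (to (from y))) (strictlyInverseˡ x)
        (gmap to (Equivalence.to (adjacency _ _))
          (to-r (from x) ◅◅ reverse (symm H) (to-r (from y)))))

  -- The index `i` is the preimage of a clique vertex of `D`. Pulled back along the isomorphism, `D`
  -- lies in N[i], where `Obstructed` leaves no room for it.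
  obstructed⇒undominated : Obstructed H → ∀ {D} → Dominating G X D → ¬ CompleteSplit G D
  obstructed⇒undominated obstructed {D} (D⊆X , dominates) split = stuck (obstructed (from x))
    where
    k = proj₁ (centre split)
    x : Vertex X
    x = k , D⊆X (proj₁ (proj₂ (centre split)))

    f : Fin m → Fin n
    f = proj₁ ∘ to

    reflects : ∀ {i j} → Adj G (f i) (f j) → Adj H i j
    reflects = Equivalence.from (adjacency _ _)

    pull : ∀ {v} (v∈X : v ∈ X) → f (from (v , v∈X)) ≡ v
    pull v∈X = cong proj₁ (strictlyInverseˡ (_ , v∈X))

    near : ∀ {i} (y : Vertex X) → proj₁ y ≡ f i ⊎ Adj G (proj₁ y) (f i) → InNbhd H i (from y)
    near {i} y (inj₁ y≡fi) = inj₁ (trans (cong from (vertex-≡ y≡fi)) (strictlyInverseʳ i))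
      where
      open Inverse bijection using (strictlyInverseʳ)
      vertex-≡ : ∀ {a b : Vertex X} → proj₁ a ≡ proj₁ b → a ≡ b
      vertex-≡ refl = cong (_ ,_) ([]=-irrelevant _ _)
    near {i} y (inj₂ y~fi) = inj₂ (reflects (subst (λ v → Adj G v (f i)) (sym (pull (proj₂ y))) y~fi))

    Dominator : Fin m → Set
    Dominator j = ∃[ t ] (f t ∈ D × InNbhd H (from x) t × InNbhd H j t)

    dominated-by : ∀ {j v} → v ∈ D → v ≡ f j ⊎ Adj G v (f j) → Dominator j
    dominated-by v∈D v-near
      = from (_ , D⊆X v∈D)
      , subst (_∈ D) (sym (pull (D⊆X v∈D))) v∈D
      , near (_ , D⊆X v∈D) (subst (λ c → _ ≡ c ⊎ Adj G _ c) (sym (pull (proj₂ x)))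
                              (proj₂ (proj₂ (centre split)) v∈D))
      , near (_ , D⊆X v∈D) v-near

    dominator : ∀ j → Dominator j
    dominator j with f j ∈? D
    ... | yes fj∈D = dominated-by fj∈D (inj₁ refl)
    ... | no fj∉D with dominates (proj₂ (to j)) fj∉D
    ...   | v , v∈D , fj~v = dominated-by v∈D (inj₂ (symm G fj~v))

    forced : ∀ {u} → Forced H (from x) u → f u ∈ D
    forced (j , only) with dominator j
    ... | t , t∈D , t-i , t-j = subst (λ u → f u ∈ D) (only t t-i t-j) t∈D

    stuck : ¬ ((∃[ j ] Far H (from x) j) ⊎ ForcedCoP₃ H (from x))
    stuck (inj₁ (j , far)) with dominator j
    ... | t , _ , t-i , t-j = far t t-i t-j
    stuck (inj₂ (u , v , w , uv , ¬wu , ¬wv , fu , fv , fw))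
      with split-edge split (forced fu) (forced fv) (forced fw) (Equivalence.to (adjacency u v) uv)
    ... | inj₁ wu = ¬wu (reflects wu)
    ... | inj₂ wv = ¬wv (reflects wv)

DominatedBySplit : Graph n → Set
DominatedBySplit G = ∀ X → Connected G X → ∃[ D ] (Dominating G X D × CompleteSplit G D)

dominated⇒no-copy : {G : Graph n} → DominatedBySplit G → (H : Graph m) (r : Fin m) →
  True (all? λ i → reach? H 4 i r) → True (obstructed? H) → ¬ (∃[ X ] H ≅ G [ X ])
dominated⇒no-copy dominated H r reach obstructed (X , copy)
  with dominated X (copy-connected copy r (λ i → reach⇒star H 4 (toWitness reach i)))
... | D , dominating , split = obstructed⇒undominated copy (toWitness obstructed) dominating split

dominated⇒free : {G : Graph n} → DominatedBySplit G → Free 𝒟 G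
dominated⇒free dominated =
    -- Leaves are numbered first, so `4F` is on the cycle of `Q₂` and `3F` is the vertex a of the
    -- paw in `Q₅`. Every vertex is within distance 3 of the chosen root, below the search bound 4.
    dominated⇒no-copy dominated (path 6)  2F tt tt
  ∷ dominated⇒no-copy dominated (cycle 6) 0F tt tt
  ∷ dominated⇒no-copy dominated Q₂        4F tt tt
  ∷ dominated⇒no-copy dominated Q₅        3F tt tt
  ∷ []

-- Minimum connected dominating sets

module _ (G : Graph n) where
  infix 4 _~_

  _~_ : Fin n → Fin n → Set
  u ~ v = Adj G u v

  ~⇒≢ : ∀ {u v} → u ~ v → u ≢ v
  ~⇒≢ uv u≡v = irrefl G u≡v uv

  separated : ∀ {u v w} → u ~ w → ¬ v ~ w → u ≢ v
  separated uw ¬vw refl = ¬vw uw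

  -- Walks inside D, as a relation on all vertices so that D can vary.
  Linked : Subset n → Fin n → Fin n → Set
  Linked D = Star (λ u v → u ∈ D × v ∈ D × u ~ v)

  linked-⊆ : ∀ {D E u v} → D ⊆ E → Linked D u v → Linked E u v
  linked-⊆ D⊆E = gmap id λ (u∈ , v∈ , uv) → D⊆E u∈ , D⊆E v∈ , uv

  connected⇒linked : ∀ {D u v} → Connected G D → u ∈ D → v ∈ D → Linked D u v
  connected⇒linked (_ , star) u∈ v∈ =
    gmap proj₁ (λ {x} {y} xy → proj₂ x , proj₂ y , xy) (star (_ , u∈) (_ , v∈))

  linked⇒connected : ∀ {D r} → r ∈ D → (∀ {u} → u ∈ D → Linked D u r) → Connected G D
  linked⇒connected {D} r∈ to-r = (_ , r∈) , λ (_ , u∈) (_ , v∈) →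
    lift u∈ r∈ (to-r u∈) ◅◅ reverse (symm G) (lift v∈ r∈ (to-r v∈))
    where
    lift : ∀ {u v} (u∈ : u ∈ D) (v∈ : v ∈ D) → Linked D u v → Star (AdjIn G D) (u , u∈) (v , v∈)
    lift u∈ v∈ ε = subst (λ p → Star _ (_ , u∈) (_ , p)) ([]=-irrelevant u∈ v∈) ε
    lift u∈ v∈ ((_ , w∈ , uw) ◅ walk) = uw ◅ lift w∈ v∈ walk

  -- Follow the walk until its next vertex is `y`, then leave by the detour.
  reroute : ∀ {D y r u} → (∀ {z} → z ∈ D → z ~ y → Linked (D - y) z r) →
    u ≢ y → Linked D u r → Linked (D - y) u r
  reroute detour u≢y ε = ε
  reroute {y = y} detour u≢y (_◅_ {j = w} (u∈ , w∈ , uw) walk) with w ≟ y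
  ... | yes refl = detour u∈ uw
  ... | no w≢y = (x∈p∧x≢y⇒x∈p-y u∈ u≢y , x∈p∧x≢y⇒x∈p-y w∈ w≢y , uw) ◅ reroute detour w≢y walk

  -- Distinctness is implied for four or more vertices, but a b a also qualifies when a ~ b; short
  -- paths therefore come with separate inequalities.
  InducedPath : List (Fin n) → Set
  InducedPath []           = ⊤
  InducedPath (u ∷ [])     = ⊤
  InducedPath (u ∷ v ∷ vs) = u ~ v × All (λ w → ¬ u ~ w) vs × InducedPath (v ∷ vs)

  linked-to-head : ∀ {D v vs} → All (_∈ D) (v ∷ vs) → InducedPath (v ∷ vs) →
    All (λ w → Linked D w v) (v ∷ vs)
  linked-to-head {vs = []}    _ _ = ε ∷ []
  linked-to-head {vs = _ ∷ _} (v∈ ∷ w∈ ∷ ws∈) (vw , _ , path) =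
    ε ∷ All.map (_◅◅ ((w∈ , v∈ , symm G vw) ◅ ε)) (linked-to-head (w∈ ∷ ws∈) path)

  -- A neighbour z of u meets the rest of the path, for otherwise z would prolong it.
  end-removable : ∀ {D u v vs} → Connected G D → All (_∈ D) (u ∷ v ∷ vs) → All (u ≢_) vs →
    InducedPath (u ∷ v ∷ vs) → (∀ {z} → z ∈ D → ¬ InducedPath (z ∷ u ∷ v ∷ vs)) →
    Connected G (D - u)
  end-removable {D} {u} {v} {vs} connected (u∈ ∷ v∈ ∷ vs∈) u≢vs path@(uv , _ , tail) maximal =
    linked⇒connected (All.head rest∈) λ x∈ →
      reroute detour (λ { refl → x∉p-x D u x∈ }) (connected⇒linked connected (p─q⊆p D ⁅ u ⁆ x∈) v∈)
    where
    rest∈ : All (_∈ (D - u)) (v ∷ vs)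
    rest∈ = All.zipWith (λ (w∈ , u≢w) → x∈p∧x≢y⇒x∈p-y w∈ (u≢w ∘ sym)) (v∈ ∷ vs∈ , ~⇒≢ uv ∷ u≢vs)

    detour : ∀ {z} → z ∈ D → z ~ u → Linked (D - u) z v
    detour {z} z∈ zu with Any.any? (λ w → z ≟ w ⊎-dec adj? G z w) (v ∷ vs)
    ... | no ¬near = contradiction
      (zu , All.map (_∘ inj₂) (¬Any⇒All¬ (v ∷ vs) ¬near) , path) (maximal z∈)
    ... | yes near = All.lookupWith
      (λ { (w∈ , walk) (inj₁ refl) → walk
         ; (w∈ , walk) (inj₂ zw) → (x∈p∧x≢y⇒x∈p-y z∈ (~⇒≢ zu) , w∈ , zw) ◅ walk })
      (All.zip (rest∈ , linked-to-head rest∈ tail)) near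

  -- The co-P₃ is the disjoint union of an edge and a vertex.
  CoP₃Free : Subset n → Set
  CoP₃Free D = ∀ {u v w} → u ∈ D → v ∈ D → w ∈ D → u ~ v → w ~ u ⊎ w ~ v

  -- Connected graphs without induced P₄, paw and C₄

  InducedP₄ InducedPaw InducedC₄ : Fin n → Fin n → Fin n → Fin n → Set
  InducedP₄  a b c d = InducedPath (a ∷ b ∷ c ∷ d ∷ [])
  InducedPaw k a b s = k ~ a × k ~ b × k ~ s × a ~ b × ¬ a ~ s × ¬ b ~ s
  InducedC₄  a b c d = a ~ b × b ~ c × c ~ d × d ~ a × ¬ a ~ c × ¬ b ~ d × a ≢ c × b ≢ d

  infix 4 _Avoids_
  _Avoids_ : Subset n → (Fin n → Fin n → Fin n → Fin n → Set) → Set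
  D Avoids Q = ∀ {a b c d} → a ∈ D → b ∈ D → c ∈ D → d ∈ D → ¬ Q a b c d

  -- Induction along the walk: a walk of three steps without a shortcut is an induced P₄.
  distance≤2 : ∀ {D u v} → D Avoids InducedP₄ → v ∈ D → Linked D u v →
    u ≡ v ⊎ u ~ v ⊎ ∃[ w ] (w ∈ D × u ~ w × w ~ v)
  distance≤2 no-P₄ v∈ ε = inj₁ refl
  distance≤2 {u = u} {v} no-P₄ v∈ (_◅_ {j = u′} (u∈ , u′∈ , uu′) walk)
    with distance≤2 no-P₄ v∈ walk
  ... | inj₁ refl = inj₂ (inj₁ uu′)
  ... | inj₂ (inj₁ u′v) = inj₂ (inj₂ (_ , u′∈ , uu′ , u′v))
  ... | inj₂ (inj₂ (w , w∈ , u′w , wv)) with adj? G u v | adj? G u w | adj? G u′ v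
  ...   | yes uv | _      | _       = inj₂ (inj₁ uv)
  ...   | no _   | yes uw | _       = inj₂ (inj₂ (w , w∈ , uw , wv))
  ...   | no _   | no _   | yes u′v = inj₂ (inj₂ (_ , u′∈ , uu′ , u′v))
  ...   | no ¬uv | no ¬uw | no ¬u′v = contradiction
    (uu′ , ¬uw ∷ ¬uv ∷ [] , u′w , ¬u′v ∷ [] , wv , [] , tt) (no-P₄ u∈ u′∈ w∈ v∈)

  -- A vertex `w` seeing neither end of the edge has a common neighbour `x` with `u`. If `x` sees
  -- `v`, there is a paw centred at `x`; otherwise w x u v is a P₄.
  coP₃-free : ∀ {D} → Connected G D → D Avoids InducedP₄ → D Avoids InducedPaw → CoP₃Free D
  coP₃-free connected no-P₄ no-paw {u} {v} {w} u∈ v∈ w∈ uv with adj? G w u | adj? G w v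
  ... | yes wu | _      = inj₁ wu
  ... | no _   | yes wv = inj₂ wv
  ... | no ¬wu | no ¬wv with distance≤2 no-P₄ u∈ (connected⇒linked connected w∈ u∈)
  ...   | inj₁ refl = contradiction uv ¬wv
  ...   | inj₂ (inj₁ wu) = contradiction wu ¬wu
  ...   | inj₂ (inj₂ (x , x∈ , wx , xu)) with adj? G x v
  ...     | yes xv = contradiction
    (xu , xv , symm G wx , uv , ¬wu ∘ symm G , ¬wv ∘ symm G) (no-paw x∈ u∈ v∈ w∈)
  ...     | no ¬xv = contradiction
    (wx , ¬wu ∷ ¬wv ∷ [] , xu , ¬xv ∷ [] , uv , [] , tt) (no-P₄ w∈ x∈ u∈ v∈)

  -- The clique consists of the vertices adjacent to all others.
  complete-split : ∀ {D} → Connected G D → CoP₃Free D → D Avoids InducedC₄ → CompleteSplit G D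
  complete-split {D} connected@((r , r∈) , _) coP₃-free no-C₄ = record
    { S = S ; K = K
    ; cover = ⊆-antisym (λ v∈ → [ proj₁ ∘ ∈-filter⁻ S? , proj₁ ∘ ∈-filter⁻ K? ]′ (x∈p∪q⁻ S K v∈))
                        (x∈p∪q⁺ ∘ split)
    ; disjoint = λ (_ , v∈) → let v∈S , v∈K = x∈p∩q⁻ S K v∈ in
        proj₂ (∈-filter⁻ S? v∈S) (proj₂ (∈-filter⁻ K? v∈K))
    ; nonempty = clique-nonempty
    ; stable = stable
    ; clique = λ u∈ v∈ u≢v →
        symm G (proj₂ (∈-filter⁻ K? u∈) (proj₁ (∈-filter⁻ K? v∈)) (u≢v ∘ sym))
    ; complete = λ s∈ k∈ → proj₂ (∈-filter⁻ K? k∈) (proj₁ (∈-filter⁻ S? s∈))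
        λ { refl → proj₂ (∈-filter⁻ S? s∈) (proj₂ (∈-filter⁻ K? k∈)) }
    }
    where
    Universal : Fin n → Set
    Universal k = ∀ {w} → w ∈ D → w ≢ k → w ~ k

    universal? : Decidable Universal
    universal? k = Lift? (λ w → ¬? (w ≟ k) →-dec adj? G w k) D

    K? : Decidable (λ v → v ∈ D × Universal v)
    K? v = v ∈? D ×-dec universal? v

    S? : Decidable (λ v → v ∈ D × ¬ Universal v)
    S? v = v ∈? D ×-dec ¬? (universal? v)

    S = filter S?
    K = filter K?

    split : ∀ {v} → v ∈ D → v ∈ S ⊎ v ∈ K
    split {v} v∈ with universal? v
    ... | yes univ = inj₂ (∈-filter⁺ K? (v∈ , univ))
    ... | no ¬univ = inj₁ (∈-filter⁺ S? (v∈ , ¬univ))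

    non-neighbour : ∀ {v} → v ∈ S → ∃[ w ] (w ∈ D × w ≢ v × ¬ w ~ v)
    non-neighbour {v} v∈S with any? (λ w → w ∈? D ×-dec (¬? (w ≟ v) ×-dec ¬? (adj? G w v)))
    ... | yes found = found
    ... | no none = contradiction
      (λ {w} w∈ w≢v → decidable-stable (adj? G w v) λ ¬wv → none (w , w∈ , w≢v , ¬wv))
      (proj₂ (∈-filter⁻ S? v∈S))

    -- For an edge st in `S`, take non-neighbours s′ of s and t′ of t. Co-P₃-freeness forces s′ ~ t,
    -- t′ ~ s and then s′ ~ t′, so s t s′ t′ is an induced C₄.
    stable : Stable G S
    stable {s} {t} s∈S t∈S st with non-neighbour s∈S | non-neighbour t∈S
    ... | s′ , s′∈ , s′≢s , ¬s′s | t′ , t′∈ , t′≢t , ¬t′t =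
      no-C₄ s∈ t∈ s′∈ t′∈
        (st , symm G s′t , s′t′ , t′s , ¬s′s ∘ symm G , ¬t′t ∘ symm G , s′≢s ∘ sym , t′≢t ∘ sym)
      where
      s∈ = proj₁ (∈-filter⁻ S? s∈S)
      t∈ = proj₁ (∈-filter⁻ S? t∈S)
      s′t : s′ ~ t
      s′t = [ (λ s′s → contradiction s′s ¬s′s) , id ]′ (coP₃-free s∈ t∈ s′∈ st)
      t′s : t′ ~ s
      t′s = [ id , (λ t′t → contradiction t′t ¬t′t) ]′ (coP₃-free s∈ t∈ t′∈ st)
      s′t′ : s′ ~ t′
      s′t′ = [ id , (λ s′s → contradiction s′s ¬s′s) ]′ (coP₃-free t′∈ s∈ s′∈ t′s)

    -- If `r` is not universal, a walk to it from another vertex starts with an edge, whose ends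
    -- cannot both lie in the stable set `S`.
    clique-nonempty : Nonempty K
    clique-nonempty with split r∈
    ... | inj₂ r∈K = r , r∈K
    ... | inj₁ r∈S with non-neighbour r∈S
    ...   | w , w∈ , w≢r , _ with connected⇒linked connected w∈ r∈
    ...     | ε = contradiction refl w≢r
    ...     | (_ , x∈ , wx) ◅ _ with split w∈ | split x∈
    ...       | inj₂ w∈K | _        = w , w∈K
    ...       | inj₁ _   | inj₂ x∈K = _ , x∈K
    ...       | inj₁ w∈S | inj₁ x∈S = contradiction wx (stable w∈S x∈S)

  Pendant : Subset n → Set
  Pendant D = ∃[ x ] ∃[ c ] (x ∈ D × (∀ {u} → u ∈ D → x ~ u → u ≡ c))

  -- The pendant vertex sees an end of each of two opposite edges of the C₄. These are two different
  -- neighbours, but it has at most one.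
  pendant⇒C₄-free : ∀ {D} → CoP₃Free D → Pendant D → D Avoids InducedC₄
  pendant⇒C₄-free coP₃-free (x , c , x∈ , nbr) u∈ v∈ w∈ t∈ (uv , vw , wt , tu , _ , _ , u≢w , v≢t)
    with coP₃-free u∈ v∈ x∈ uv | coP₃-free w∈ t∈ x∈ wt
  ... | inj₁ xu | inj₁ xw = u≢w (trans (nbr u∈ xu) (sym (nbr w∈ xw)))
  ... | inj₁ xu | inj₂ xt = ~⇒≢ tu (trans (nbr t∈ xt) (sym (nbr u∈ xu)))
  ... | inj₂ xv | inj₁ xw = ~⇒≢ vw (trans (nbr v∈ xv) (sym (nbr w∈ xw)))
  ... | inj₂ xv | inj₂ xt = v≢t (trans (nbr v∈ xv) (sym (nbr t∈ xt)))

  -- Private neighbours and exchange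

  module _ (X : Subset n) where

    ConnectedDominating : Subset n → Set
    ConnectedDominating D = Dominating G X D × Connected G D

    Minimum : Subset n → Set
    Minimum D = ConnectedDominating D × (∀ {E} → ConnectedDominating E → ∣ D ∣ ≤ ∣ E ∣)

    -- Descent on the size, starting from `X` itself. The double negation spares deciding
    -- `ConnectedDominating`; it is removed in `free⇒solution`.
    minimum-exists : Connected G X → ¬ ¬ ∃ Minimum
    minimum-exists connected none =
      <-rec (λ k → ∀ D → ∣ D ∣ ≡ k → ¬ ConnectedDominating D)
        (λ { _ smaller D refl cds → none (D , cds , λ {E} cds′ →
          ℕ.≮⇒≥ λ E<D → smaller E<D E refl cds′) })
        _ X refl ((⊆-refl , λ v∈ v∉ → contradiction v∈ v∉) , connected)

    Undominated : Subset n → Fin n → Set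
    Undominated D v = v ∈ X × v ∉ D × (∀ {u} → u ∈ D → ¬ v ~ u)

    undominated-or-dominating : ∀ {D} → D ⊆ X → ∃ (Undominated D) ⊎ Dominating G X D
    undominated-or-dominating {D} D⊆X with
      any? (λ v → v ∈? X ×-dec (¬? (v ∈? D) ×-dec Lift? (λ u → ¬? (adj? G v u)) D))
    ... | yes found = inj₁ found
    ... | no none = inj₂ (D⊆X , dominated)
      where
      dominated : ∀ {v} → v ∈ X → v ∉ D → ∃[ u ] (u ∈ D × v ~ u)
      dominated {v} v∈ v∉ with any? (λ u → u ∈? D ×-dec adj? G v u)
      ... | yes found = found
      ... | no none′ = contradiction (v , v∈ , v∉ , λ {u} u∈ vu → none′ (u , u∈ , vu)) none

    record Private (D : Subset n) (y y′ : Fin n) : Set where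
      field
        inside-X  : y′ ∈ X
        outside-D : y′ ∉ D
        edge      : y ~ y′
        only      : ∀ {u} → u ∈ D → u ≢ y → ¬ y′ ~ u

    open Private

    -- Serves deletion (`E` is D - y) and exchange (`E` is D - y + s′). Since `b` still dominates
    -- `y`, the vertex `v` is outside `D`, and among the vertices of `D` only `y` can dominate it.
    undominated⇒private : ∀ {D E y b v} → Dominating G X D → b ∈ D → y ~ b →
      (∀ {u} → u ∈ D → u ≢ y → u ∈ E) → Undominated E v → Private D y v
    undominated⇒private {D} {E} {y} {b} {v} (_ , dominates) b∈ yb D-y⊆E (v∈X , v∉E , ¬v~E) = record
      { inside-X = v∈X ; outside-D = v∉D ; edge = y~v
      ; only = λ u∈ u≢y → ¬v~E (D-y⊆E u∈ u≢y)
      }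
      where
      v∉D : v ∉ D
      v∉D v∈D with v ≟ y
      ... | yes refl = ¬v~E (D-y⊆E b∈ (~⇒≢ yb ∘ sym)) yb
      ... | no v≢y   = v∉E (D-y⊆E v∈D v≢y)
      y~v : y ~ v
      y~v with dominates v∈X v∉D
      ... | u , u∈ , vu with u ≟ y
      ...   | yes refl = symm G vu
      ...   | no u≢y   = contradiction vu (¬v~E (D-y⊆E u∈ u≢y))

    -- Otherwise D - y would be a smaller connected dominating set.
    private-exists : ∀ {D y b} → Minimum D → y ∈ D → b ∈ D → y ~ b → Connected G (D - y) →
      ∃ (Private D y)
    private-exists {D} {y} (((D⊆X , dominates) , _) , least) y∈ b∈ yb connected
      with undominated-or-dominating {D - y} (D⊆X ∘ p─q⊆p D ⁅ y ⁆)
    ... | inj₁ (v , undominated) =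
      v , undominated⇒private (D⊆X , dominates) b∈ yb x∈p∧x≢y⇒x∈p-y undominated
    ... | inj₂ dominating =
      contradiction (least (dominating , connected)) (ℕ.<⇒≱ (x∈p⇒∣p-x∣<∣p∣ y∈))

    infixl 5 _[_↦_]
    _[_↦_] : Subset n → Fin n → Fin n → Subset n
    D [ y ↦ s′ ] = (D - y) ∪ ⁅ s′ ⁆

    module _ {D : Subset n} {y s′ : Fin n} where

      ∈-swap-old : ∀ {u} → u ∈ D → u ≢ y → u ∈ D [ y ↦ s′ ]
      ∈-swap-old u∈ u≢y = x∈p∪q⁺ (inj₁ (x∈p∧x≢y⇒x∈p-y u∈ u≢y))

      ∈-swap-new : s′ ∈ D [ y ↦ s′ ]
      ∈-swap-new = x∈p∪q⁺ (inj₂ (x∈⁅x⁆ s′))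

      ∈-swap⁻ : ∀ {u} → u ∈ D [ y ↦ s′ ] → u ∈ D - y ⊎ u ≡ s′
      ∈-swap⁻ u∈ = [ inj₁ , inj₂ ∘ x∈⁅y⁆⇒x≡y s′ ]′ (x∈p∪q⁻ (D - y) ⁅ s′ ⁆ u∈)

    -- A vertex that D - y + s′ leaves undominated is the required `y′`. If there is none, the new
    -- set is connected, as `s′` hangs on `s`, and no larger than `D`.
    exchange : ∀ {D y b s s′} → Minimum D → y ∈ D → b ∈ D → y ~ b → Connected G (D - y) →
      s ∈ D → s ≢ y → Private D s s′ →
      (∃[ y′ ] (Private D y y′ × ¬ y′ ~ s′)) ⊎ Minimum (D [ y ↦ s′ ])
    exchange {D} {y} {s = s} {s′} (((D⊆X , dominates) , _) , least) y∈ b∈ yb connected s∈ s≢y s-s′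
      with undominated-or-dominating {D [ y ↦ s′ ]}
        (λ u∈ → [ D⊆X ∘ p─q⊆p D ⁅ y ⁆ , (λ { refl → inside-X s-s′ }) ]′ (∈-swap⁻ u∈))
    ... | inj₁ (v , undominated) = inj₁
      ( v
      , undominated⇒private (D⊆X , dominates) b∈ yb ∈-swap-old undominated
      , proj₂ (proj₂ undominated) (∈-swap-new {D} {y}))
    ... | inj₂ dominating = inj₂ ((dominating , linked⇒connected s∈E to-s) , ≤-all)
      where
      E = D [ y ↦ s′ ]
      s∈E = ∈-swap-old {D} {y} {s′} s∈ s≢y
      to-s : ∀ {u} → u ∈ E → Linked E u s
      to-s u∈ with ∈-swap⁻ u∈
      ... | inj₁ u∈D-y = linked-⊆ (x∈p∪q⁺ ∘ inj₁)
        (connected⇒linked connected u∈D-y (x∈p∧x≢y⇒x∈p-y s∈ s≢y))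
      ... | inj₂ refl = (u∈ , s∈E , symm G (edge s-s′)) ◅ ε
      ≤-all : ∀ {F} → ConnectedDominating F → ∣ E ∣ ≤ ∣ F ∣
      ≤-all cds = ℕ.≤-trans (ℕ.≤-trans (∣p∪⁅x⁆∣≤1+∣p∣ (D - y) s′) (x∈p⇒∣p-x∣<∣p∣ y∈)) (least cds)

    private-path : ∀ {D y y′ v vs} → Private D y y′ → All (_∈ D) (v ∷ vs) → All (_≢ y) (v ∷ vs) →
      InducedPath (y ∷ v ∷ vs) → InducedPath (y′ ∷ y ∷ v ∷ vs)
    private-path y-y′ vs∈ vs≢y path =
      symm G (edge y-y′) , All.zipWith (uncurry (only y-y′)) (vs∈ , vs≢y) , path

    -- In `D`, the private neighbour `s′` sees only `s`, and the exchange adds nothing but `s′`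
    -- itself.
    swap-pendant : ∀ {D y s s′} → Private D s s′ → Pendant (D [ y ↦ s′ ])
    swap-pendant {D} {y} {s} {s′} s-s′ = s′ , s , ∈-swap-new {D} , nbr
      where
      nbr : ∀ {u} → u ∈ D [ y ↦ s′ ] → s′ ~ u → u ≡ s
      nbr {u} u∈ s′u with ∈-swap⁻ u∈ | u ≟ s
      ... | _          | yes u≡s = u≡s
      ... | inj₁ u∈D-y | no u≢s  = contradiction s′u (only s-s′ (p─q⊆p D ⁅ y ⁆ u∈D-y) u≢s)
      ... | inj₂ refl  | no _    = contradiction s′u (irrefl G refl)

    -- Deciding whether a solution exists

    Solution : Set
    Solution = ∃[ D ] (Dominating G X D × CompleteSplit G D)

    solution? : Dec Solution
    solution? = anySubset? λ D → dominating? D ×-dec completeSplit? D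
      where
      dominating? : ∀ D → Dec (Dominating G X D)
      dominating? D with D ⊆? X
      ... | no D⊈X = no (D⊈X ∘ proj₁)
      ... | yes D⊆X with undominated-or-dominating D⊆X
      ...   | inj₂ dominating = yes dominating
      ...   | inj₁ (v , v∈ , v∉ , ¬v~D) = no λ (_ , dominates) →
        let u , u∈ , vu = dominates v∈ v∉ in ¬v~D u∈ vu

      pairs? : ∀ A B {P : Fin n → Fin n → Set} → (∀ u v → Dec (P u v)) →
        Dec (∀ {u v} → u ∈ A → v ∈ B → P u v)
      pairs? A B P? = map′ (λ p {u} {v} u∈ v∈ → p {u} u∈ {v} v∈) (λ p {u} u∈ {v} v∈ → p {u} {v} u∈ v∈)
        (Lift? (λ u → Lift? (P? u) B) A)

      SplitInto : Subset n → Subset n → Subset n → Set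
      SplitInto D S K = S ∪ K ≡ D × Empty (S ∩ K) × Nonempty K × Stable G S × Clique G K
        × (∀ {s k} → s ∈ S → k ∈ K → s ~ k)

      splitInto? : ∀ D S K → Dec (SplitInto D S K)
      splitInto? D S K = ≡-dec _≟ᵇ_ (S ∪ K) D ×-dec (¬? (nonempty? (S ∩ K)) ×-dec (nonempty? K ×-dec
        (pairs? S S (λ u v → ¬? (adj? G u v)) ×-dec
        (pairs? K K (λ u v → ¬? (u ≟ v) →-dec adj? G u v) ×-dec
         pairs? S K (adj? G)))))

      pack : ∀ {D} → ∃[ S ] ∃[ K ] SplitInto D S K → CompleteSplit G D
      pack (S , K , cover , disjoint , nonempty , stable , clique , complete) = record
        { S = S ; K = K ; cover = cover ; disjoint = disjoint ; nonempty = nonempty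
        ; stable = stable ; clique = clique ; complete = complete }

      unpack : ∀ {D} → CompleteSplit G D → ∃[ S ] ∃[ K ] SplitInto D S K
      unpack split = S , K , cover , disjoint , nonempty , stable , clique , complete
        where open CompleteSplit split

      completeSplit? : ∀ D → Dec (CompleteSplit G D)
      completeSplit? D = map′ pack unpack (anySubset? λ S → anySubset? λ K → splitInto? D S K)

    -- Minimum sets in a 𝒟-free graph

    module _ (free : Free 𝒟 G) where

      -- Adjacency of the two ends `a` and `f` is left open: it decides between C₆ and P₆.
      no-long-path : ∀ {a b c d e f} → InducedPath (a ∷ b ∷ c ∷ d ∷ e ∷ []) →
        e ~ f → ¬ f ~ b → ¬ f ~ c → ¬ f ~ d → ⊥
      no-long-path {a} {b} {c} {d} {e} {f}
        (ab , ¬ac ∷ ¬ad ∷ ¬ae ∷ [] , bc , ¬bd ∷ ¬be ∷ [] , cd , ¬ce ∷ [] , de , _)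
        ef ¬fb ¬fc ¬fd with adj? G a f
      ... | yes af = All.lookup free (there (here refl)) (induced-copy G (cycle 6) C₆-twinFree
        (a ∷ b ∷ c ∷ d ∷ e ∷ f ∷ [])
        ( (ab , ¬ac , ¬ad , ¬ae , af , tt)
        , (bc , ¬bd , ¬be , ¬fb ∘ symm G , tt)
        , (cd , ¬ce , ¬fc ∘ symm G , tt)
        , (de , ¬fd ∘ symm G , tt)
        , (ef , tt) , tt , tt))
      ... | no ¬af = All.lookup free (here refl) (induced-copy G (path 6) P₆-twinFree
        (a ∷ b ∷ c ∷ d ∷ e ∷ f ∷ [])
        ( (ab , ¬ac , ¬ad , ¬ae , ¬af , tt)
        , (bc , ¬bd , ¬be , ¬fb ∘ symm G , tt)
        , (cd , ¬ce , ¬fc ∘ symm G , tt)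
        , (de , ¬fd ∘ symm G , tt)
        , (ef , tt) , tt , tt))

      no-P₆ : ∀ {a b c d e f} → ¬ InducedPath (a ∷ b ∷ c ∷ d ∷ e ∷ f ∷ [])
      no-P₆ (ab , ¬ac ∷ ¬ad ∷ ¬ae ∷ _ , bc , ¬bd ∷ ¬be ∷ ¬bf ∷ [] , cd , ¬ce ∷ ¬cf ∷ []
            , de , ¬df ∷ [] , ef , _) =
        no-long-path
          (ab , ¬ac ∷ ¬ad ∷ ¬ae ∷ [] , bc , ¬bd ∷ ¬be ∷ [] , cd , ¬ce ∷ [] , de , [] , tt)
          ef (¬bf ∘ symm G) (¬cf ∘ symm G) (¬df ∘ symm G)

      -- With P₆ excluded, a P₅ in `D` cannot be prolonged, so its end is removable; a private
      -- neighbour of that end then yields a P₆.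
      no-P₅ : ∀ {D a b c d e} → Minimum D → All (_∈ D) (a ∷ b ∷ c ∷ d ∷ e ∷ []) →
        ¬ InducedPath (a ∷ b ∷ c ∷ d ∷ e ∷ [])
      no-P₅ min@((_ , connected) , _) D∋@(a∈ ∷ b∈ ∷ rest∈)
        path@(ab , ¬ac ∷ ¬ad ∷ _ ∷ [] , _ , _ , cd , _ , de , _)
        with c≢a ← separated cd ¬ad | d≢a ← separated (symm G cd) ¬ac | e≢a ← separated (symm G de) ¬ad
        with private-exists min a∈ b∈ ab (end-removable connected D∋
               ((c≢a ∘ sym) ∷ (d≢a ∘ sym) ∷ (e≢a ∘ sym) ∷ []) path (λ _ → no-P₆))
      ... | _ , a-a′ =
        no-P₆ (private-path a-a′ (b∈ ∷ rest∈) (~⇒≢ ab ∘ sym ∷ c≢a ∷ d≢a ∷ e≢a ∷ []) path)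

      no-P₄ : ∀ {D} → Minimum D → D Avoids InducedP₄
      no-P₄ min@((_ , connected) , _) a∈ b∈ c∈ d∈ path@(ab , ¬ac ∷ ¬ad ∷ [] , bc , ¬bd ∷ [] , cd , _)
        with c≢a ← separated cd ¬ad | d≢a ← separated (symm G cd) ¬ac
           | b≢d ← separated (symm G ab) (¬ad ∘ symm G)
        with private-exists min a∈ b∈ ab
               (end-removable connected (a∈ ∷ b∈ ∷ c∈ ∷ d∈ ∷ []) (c≢a ∘ sym ∷ d≢a ∘ sym ∷ []) path
                 λ z∈ → no-P₅ min (z∈ ∷ a∈ ∷ b∈ ∷ c∈ ∷ d∈ ∷ []))
           | private-exists min d∈ c∈ (symm G cd)
               (end-removable connected (d∈ ∷ c∈ ∷ b∈ ∷ a∈ ∷ []) (b≢d ∘ sym ∷ d≢a ∷ [])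
                 (symm G cd , ¬bd ∘ symm G ∷ ¬ad ∘ symm G ∷ [] , symm G bc , ¬ac ∘ symm G ∷ [] , symm G ab , [] , tt)
                 λ z∈ → no-P₅ min (z∈ ∷ d∈ ∷ c∈ ∷ b∈ ∷ a∈ ∷ []))
      ... | _ , a-a′ | _ , d-d′ = no-long-path
        (private-path a-a′ (b∈ ∷ c∈ ∷ d∈ ∷ []) (~⇒≢ ab ∘ sym ∷ c≢a ∷ d≢a ∷ []) path)
        (edge d-d′) (only d-d′ a∈ (d≢a ∘ sym)) (only d-d′ b∈ b≢d) (only d-d′ c∈ (~⇒≢ cd))

      -- With P₄ excluded from `D`, no vertex of `D` prolongs the path y k s, so `end-removable`
      -- applies to `y`.
      private-of-P₃ : ∀ {D y k s} → Minimum D → y ∈ D → k ∈ D → s ∈ D →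
        y ~ k → k ~ s → ¬ y ~ s → y ≢ s → Connected G (D - y) × ∃ (Private D y)
      private-of-P₃ {D} {y} min@((_ , connected) , _) y∈ k∈ s∈ yk ks ¬ys y≢s =
        removable , private-exists min y∈ k∈ yk removable
        where
        removable : Connected G (D - y)
        removable = end-removable connected (y∈ ∷ k∈ ∷ s∈ ∷ []) (y≢s ∷ [])
          (yk , ¬ys ∷ [] , ks , [] , tt) λ z∈ → no-P₄ min z∈ y∈ k∈ s∈

      -- Otherwise d′ d c b b′ w′ would be an induced path or cycle.
      privates-nonadjacent : ∀ {D b c d w b′ d′ w′} → b ∈ D → c ∈ D → d ∈ D → w ∈ D →
        b ~ c → c ~ d → ¬ b ~ d → b ≢ d → b ≢ w → c ≢ w → d ≢ w →
        Private D b b′ → Private D d d′ → Private D w w′ → ¬ b′ ~ d′ → ¬ b′ ~ w′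
      privates-nonadjacent b∈ c∈ d∈ w∈ bc cd ¬bd b≢d b≢w c≢w d≢w b-b′ d-d′ w-w′ ¬b′d′ b′w′ =
        no-long-path
          ( symm G (edge d-d′) , only d-d′ c∈ (~⇒≢ cd) ∷ only d-d′ b∈ b≢d ∷ ¬b′d′ ∘ symm G ∷ []
          , symm G cd , ¬bd ∘ symm G ∷ only b-b′ d∈ (b≢d ∘ sym) ∘ symm G ∷ []
          , symm G bc , only b-b′ c∈ (~⇒≢ bc ∘ sym) ∘ symm G ∷ []
          , edge b-b′ , [] , tt)
          b′w′ (only w-w′ d∈ d≢w) (only w-w′ c∈ c≢w) (only w-w′ b∈ b≢w)

      no-paw : ∀ {D} → Minimum D → D Avoids InducedPaw
      no-paw {D} min {k} {y} {t} {s} k∈ y∈ t∈ s∈ (ky , kt , ks , yt , ¬ys , ¬ts)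
        with y≢s ← separated yt (¬ts ∘ symm G) | t≢s ← separated (symm G yt) (¬ys ∘ symm G)
        with private-of-P₃ min s∈ k∈ y∈ (symm G ks) ky (¬ys ∘ symm G) (y≢s ∘ sym)
      ... | _ , s′ , s-s′
        with nonadjacent-private y∈ t∈ ky kt yt ¬ys ¬ts y≢s
           | nonadjacent-private t∈ y∈ kt ky (symm G yt) ¬ts ¬ys t≢s
        where
        nonadjacent-private : ∀ {y t} → y ∈ D → t ∈ D → k ~ y → k ~ t → y ~ t →
          ¬ y ~ s → ¬ t ~ s → y ≢ s → ∃[ y′ ] (Private D y y′ × ¬ y′ ~ s′)
        nonadjacent-private y∈ t∈ ky kt yt ¬ys ¬ts y≢s
          with exchange min y∈ k∈ (symm G ky)
                 (proj₁ (private-of-P₃ min y∈ k∈ s∈ (symm G ky) ks ¬ys y≢s)) s∈ (y≢s ∘ sym) s-s′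
        ... | inj₁ found = found
        ... | inj₂ min′ = contradiction
          ( symm G kt , ¬ts ∷ only s-s′ t∈ (separated (symm G yt) (¬ys ∘ symm G)) ∘ symm G ∷ []
          , ks , only s-s′ k∈ (~⇒≢ ks) ∘ symm G ∷ [] , edge s-s′ , [] , tt)
          (no-P₄ min′ (∈-swap-old t∈ (~⇒≢ yt ∘ sym)) (∈-swap-old k∈ (~⇒≢ ky))
                      (∈-swap-old s∈ (y≢s ∘ sym)) (∈-swap-new {D}))
      ... | y′ , y-y′ , ¬y′s′ | t′ , t-t′ , ¬t′s′ =
        All.lookup free (there (there (there (here refl)))) (induced-copy G Q₅ Q₅-twinFree
          -- The order is that of `Q₅`: three leaves, then k, y, t, s as a, b, c, d. An edge y′t′
          -- would give the path or cycle s′ s k y y′ t′.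
          (y′ ∷ t′ ∷ s′ ∷ k ∷ y ∷ t ∷ s ∷ [])
          ( ( privates-nonadjacent y∈ k∈ s∈ t∈ (symm G ky) ks ¬ys y≢s (~⇒≢ yt) (~⇒≢ kt) (t≢s ∘ sym)
                y-y′ s-s′ t-t′ ¬y′s′
            , ¬y′s′ , only y-y′ k∈ (~⇒≢ ky) , symm G (edge y-y′)
            , only y-y′ t∈ (~⇒≢ yt ∘ sym) , only y-y′ s∈ (y≢s ∘ sym) , tt)
          , ( ¬t′s′ , only t-t′ k∈ (~⇒≢ kt) , only t-t′ y∈ (~⇒≢ yt)
            , symm G (edge t-t′) , only t-t′ s∈ (t≢s ∘ sym) , tt)
          , (only s-s′ k∈ (~⇒≢ ks) , only s-s′ y∈ y≢s , only s-s′ t∈ t≢s , symm G (edge s-s′) , tt)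
          , (ky , kt , ks , tt)
          , (yt , ¬ys , tt)
          , (¬ts , tt)
          , tt , tt))

      C₄⇒pendant : ∀ {D a b c d} → Minimum D → a ∈ D → b ∈ D → c ∈ D → d ∈ D → InducedC₄ a b c d →
        ∃[ E ] (Minimum E × Pendant E)
      C₄⇒pendant {D} {a} {b} {c} {d} min a∈ b∈ c∈ d∈ (ab , bc , cd , da , ¬ac , ¬bd , a≢c , b≢d)
        with opposite a∈ b∈ c∈ ab bc ¬ac a≢c | opposite b∈ c∈ d∈ bc cd ¬bd b≢d
        where
        opposite : ∀ {a b c} → a ∈ D → b ∈ D → c ∈ D → a ~ b → b ~ c → ¬ a ~ c → a ≢ c →
          (∃[ a′ ] ∃[ c′ ] (Private D a a′ × Private D c c′ × ¬ a′ ~ c′))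
          ⊎ (∃[ E ] (Minimum E × Pendant E))
        opposite a∈ b∈ c∈ ab bc ¬ac a≢c
          with private-of-P₃ min c∈ b∈ a∈ (symm G bc) (symm G ab) (¬ac ∘ symm G) (a≢c ∘ sym)
        ... | _ , c′ , c-c′
          with exchange min a∈ b∈ ab (proj₁ (private-of-P₃ min a∈ b∈ c∈ ab bc ¬ac a≢c))
                 c∈ (a≢c ∘ sym) c-c′
        ...   | inj₁ (a′ , a-a′ , ¬a′c′) = inj₁ (a′ , c′ , a-a′ , c-c′ , ¬a′c′)
        ...   | inj₂ min′ = inj₂ (_ , min′ , swap-pendant c-c′)
      ... | inj₂ found | _ = found
      ... | inj₁ _ | inj₂ found = found
      ... | inj₁ (a′ , c′ , a-a′ , c-c′ , ¬a′c′) | inj₁ (b′ , d′ , b-b′ , d-d′ , ¬b′d′) =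
        ⊥-elim (All.lookup free (there (there (here refl))) (induced-copy G Q₂ Q₂-twinFree
          (a′ ∷ b′ ∷ c′ ∷ d′ ∷ a ∷ b ∷ c ∷ d ∷ [])
          ( ( ¬b′a′ ∘ symm G , ¬a′c′ , ¬d′a′ ∘ symm G
            , symm G (edge a-a′) , only a-a′ b∈ b≢a , only a-a′ c∈ c≢a , only a-a′ d∈ d≢a , tt)
          , ( ¬b′c′ , ¬b′d′
            , only b-b′ a∈ a≢b , symm G (edge b-b′) , only b-b′ c∈ c≢b , only b-b′ d∈ d≢b , tt)
          , ( ¬d′c′ ∘ symm G
            , only c-c′ a∈ a≢c , only c-c′ b∈ b≢c , symm G (edge c-c′) , only c-c′ d∈ d≢c , tt)
          , ( only d-d′ a∈ a≢d , only d-d′ b∈ b≢d , only d-d′ c∈ c≢d , symm G (edge d-d′) , tt)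
          , (ab , ¬ac , symm G da , tt)
          , (bc , ¬bd , tt)
          , (cd , tt)
          , tt , tt)))
        where
        a≢b = ~⇒≢ ab
        b≢a = ~⇒≢ ab ∘ sym
        b≢c = ~⇒≢ bc
        c≢b = ~⇒≢ bc ∘ sym
        c≢d = ~⇒≢ cd
        d≢c = ~⇒≢ cd ∘ sym
        d≢a = ~⇒≢ da
        a≢d = ~⇒≢ da ∘ sym
        c≢a = a≢c ∘ sym
        d≢b = b≢d ∘ sym
        -- The path between b and d runs through whichever of a and c does not own the third private
        -- neighbour.
        ¬b′a′ = privates-nonadjacent b∈ c∈ d∈ a∈ bc cd ¬bd b≢d b≢a c≢a d≢a b-b′ d-d′ a-a′ ¬b′d′
        ¬b′c′ = privates-nonadjacent b∈ a∈ d∈ c∈ (symm G ab) (symm G da) ¬bd b≢d b≢c a≢c d≢c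
          b-b′ d-d′ c-c′ ¬b′d′
        ¬d′a′ = privates-nonadjacent d∈ c∈ b∈ a∈ (symm G cd) (symm G bc) (¬bd ∘ symm G) d≢b d≢a c≢a b≢a
          d-d′ b-b′ a-a′ (¬b′d′ ∘ symm G)
        ¬d′c′ = privates-nonadjacent d∈ a∈ b∈ c∈ da ab (¬bd ∘ symm G) d≢b d≢c a≢c b≢c
          d-d′ b-b′ c-c′ (¬b′d′ ∘ symm G)

      minimum-coP₃-free : ∀ {D} → Minimum D → CoP₃Free D
      minimum-coP₃-free min@((_ , connected) , _) =
        coP₃-free connected (no-P₄ min) (no-paw min)

      solve : ∀ {D} → Minimum D → D Avoids InducedC₄ → Solution
      solve min@((dominating , connected) , _) no-C₄ =
        _ , dominating , complete-split connected (minimum-coP₃-free min) no-C₄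

      -- One exchange suffices: the new minimum set has a pendant vertex and so contains no C₄ at
      -- all.
      free⇒solution : Connected G X → Solution
      free⇒solution connected = decidable-stable solution? λ none →
        minimum-exists connected λ (D , min) →
          none (solve min λ a∈ b∈ c∈ d∈ C₄ →
            let E , min′ , pendant = C₄⇒pendant min a∈ b∈ c∈ d∈ C₄
            in none (solve min′ (pendant⇒C₄-free (minimum-coP₃-free min′) pendant)))

theorem3p2 : ∀ (n : ℕ) (G : Graph n) →
    (∀ (X : Subset n) → Connected G X →
    ∃[ D ] (Dominating G X D × CompleteSplit G D))
    ⇔ Free 𝒟 G
theorem3p2 n G = mk⇔ dominated⇒free λ free X → free⇒solution G X free
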